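{- Let $k\ge 3$ be an integer. Then $W_c(k,3)>k^2$.
   Context: For positive integers $k,N,d$ with $k\ge 3$, a $k$-term cyclic arithmetic progression mod $N$ with common difference $d$ is a $k$-element subset of $\mathbb{Z}_N=\mathbb{Z}/N\mathbb{Z}$ of the form $\{t,t+d,\ldots,t+(k-1)d\}$ for some $t\in\mathbb{Z}_N$ (so these $k$ elements are pairwise distinct mod $N$). An $r$-coloring of a set $S$ is a map $c:S\to\{1,\ldots,r\}$; a subset of $S$ is monochromatic if $c$ is constant on it. For integers $k\ge 3$, $r\ge 2$, the cyclic Van der Waerden number $W_c(k,r)$ is the smallest modulus $N$ such that for all positive integers $M\ge N$ and every $r$-coloring of $\mathbb{Z}_M$, there exists a monochromatic $k$-term cyclic arithmetic progression mod $M$ in $\mathbb{Z}_M$. (This number always exists.) -}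

module Defs where

open import Data.Nat using (ℕ; NonZero; _+_; _*_; _≤_)
open import Data.Nat.DivMod using (_mod_)
open import Data.Fin using (Fin; toℕ)
open import Data.Fin.Subset using (Subset; _∈_; ∣_∣)
open import Data.Product using (_×_; ∃-syntax)
open import Function.Bundles using (_⇔_)
open import Relation.Binary.PropositionalEquality using (_≡_)

-- ℤ_M is represented by Fin M, with residues computed by _mod_.

term : (M : ℕ) .{{_ : NonZero M}} → Fin M → ℕ → ℕ → Fin M
term M t d i = (toℕ t + i * d) mod M

-- The cardinality condition is what forces the k terms to be pairwise
-- distinct mod M.
IsCyclicAP : (k M : ℕ) .{{_ : NonZero M}} → (d : ℕ) → Subset M → Set
IsCyclicAP k M d A =
  ∣ A ∣ ≡ k ×
  ∃[ t ] (∀ x → x ∈ A ⇔ (∃[ i ] x ≡ term M t d (toℕ {k} i)))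

Coloring : (r M : ℕ) → Set
Coloring r M = Fin M → Fin r

Monochromatic : {r M : ℕ} → Coloring r M → Subset M → Set
Monochromatic c A = ∀ x y → x ∈ A → y ∈ A → c x ≡ c y

HasMonochromaticAP : (k r M : ℕ) .{{_ : NonZero M}} → Coloring r M → Set
HasMonochromaticAP k r M c =
  ∃[ d ] 1 ≤ d × (∃[ A ] IsCyclicAP k M d A × Monochromatic c A)

AllForcedFrom : (k r N : ℕ) → Set
AllForcedFrom k r N =
  ∀ M .{{_ : NonZero M}} → N ≤ M → (c : Coloring r M) → HasMonochromaticAP k r M c

-- The cyclic Van der Waerden number is given by its graph: this says
-- W_c(k, r) = W.  The least element is unique, and it exists by Van der
-- Waerden's theorem.
record IsCyclicVanDerWaerdenNumber (k r W : ℕ) : Set where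
  field
    positive : 1 ≤ W
    forced   : AllForcedFrom k r W
    least    : ∀ N → 1 ≤ N → AllForcedFrom k r N → W ≤ N

{-# OPTIONS --safe #-}

-- Take m ∈ {k − 1, k} odd and M = 2(k − 1)m.  Each residue class r mod m avoids
-- one of three colours, according to which third of [0, m) contains r, and is
-- split between the other two colours into halves of k − 1 elements.  If m ∣ d, an
-- AP lies in one class, where it is too long to be monochromatic.  If m ∤ d,
-- then g = gcd(d, m) is a proper divisor of the odd number m, so g ≤ m/3; the
-- first m ≤ k terms of the AP cover a whole class mod g, which meets every
-- interval of length m/3, so for each colour some term avoids it.
module Submission where

open import Defs
open import Data.Nat using (ℕ; zero; suc; _+_; _*_; _∸_; _≤_; _<_; _>_; _^_; NonZero; z≤n; s≤s; ≢-nonZero; >-nonZero)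
open import Data.Nat.Properties hiding (suc-injective)
open import Data.Nat.DivMod
open import Data.Nat.Divisibility using (_∣_; divides; _∣?_; n∣m*n; ∣m+n∣m⇒∣n; ∣1⇒≡1)
open import Data.Nat.GCD using (gcd; gcd-GCD; gcd[m,n]∣m; gcd[m,n]∣n; gcd[m,n]≢0; module Bézout)
open import Data.Nat.Tactic.RingSolver using (solve-∀)
open import Data.Bool using (true; false)
open import Data.Fin using (Fin; zero; suc; toℕ; fromℕ<; punchIn)
open import Data.Fin.Properties using (toℕ<n; toℕ-injective; toℕ-fromℕ<; fromℕ<-injective; punchIn-injective; punchInᵢ≢i; injective⇒≤; suc-injective)
open import Data.Fin.Subset using (Subset; _∈_; ∣_∣)
open import Data.Product using (_×_; _,_; ∃-syntax)
open import Data.Sum using (inj₂)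
open import Data.Vec using (_∷_; here; there)
open import Function.Bundles using (module Equivalence)
open import Relation.Nullary using (¬_; yes; no; contradiction)
open import Relation.Binary.PropositionalEquality using (_≡_; _≢_; refl; sym; trans; cong; cong₂; subst; module ≡-Reasoning)

-- Pigeonhole principle for subsets.

element : ∀ {n} (A : Subset n) → Fin ∣ A ∣ → Fin n
element (true  ∷ A) zero    = zero
element (true  ∷ A) (suc i) = suc (element A i)
element (false ∷ A) i       = suc (element A i)

element-∈ : ∀ {n} (A : Subset n) i → element A i ∈ A
element-∈ (true  ∷ A) zero    = here
element-∈ (true  ∷ A) (suc i) = there (element-∈ A i)
element-∈ (false ∷ A) i       = there (element-∈ A i)

element-injective : ∀ {n} (A : Subset n) {i j} → element A i ≡ element A j → i ≡ j
element-injective (true  ∷ A) {zero}  {zero}  eq = refl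
element-injective (true  ∷ A) {suc i} {suc j} eq = cong suc (element-injective A (suc-injective eq))
element-injective (false ∷ A)                 eq = element-injective A (suc-injective eq)

∣A∣≤-injectiveOn : ∀ {n b} (A : Subset n) (f : Fin n → Fin b) →
                   (∀ x y → x ∈ A → y ∈ A → f x ≡ f y → x ≡ y) → ∣ A ∣ ≤ b
∣A∣≤-injectiveOn A f f-inj =
  injective⇒≤ {f = λ i → f (element A i)} λ {i} {j} eq →
    element-injective A (f-inj _ _ (element-∈ A i) (element-∈ A j) eq)

-- Arithmetic modulo `m`: gcds, progressions and remainders.

bézout-mod : ∀ d m .{{_ : NonZero m}} → ∃[ e ] ∃[ a ] ∃[ b ] e * d + a * m ≡ gcd d m + b * m
bézout-mod d m@(suc m-1) with Bézout.identity (gcd-GCD d m)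
... | Bézout.+- x y eq = x , 0 , y , trans (+-identityʳ _) (sym eq)
-- Here the coefficient of `d` is negative; `x * m-1` is a natural number congruent to `-x` modulo
-- `m`.
... | Bézout.-+ x y eq = x * m-1 , y , x * d , (begin
  x * m-1 * d + y * m               ≡⟨ cong (x * m-1 * d +_) eq ⟨
  x * m-1 * d + (gcd d m + x * d)   ≡⟨ rearrange x d m-1 (gcd d m) ⟩
  gcd d m + x * d * m               ∎)
  where
  open ≡-Reasoning
  rearrange : ∀ x d n g → x * n * d + (g + x * d) ≡ g + x * d * suc n
  rearrange = solve-∀

-- Multiply the Bézout congruence by `n`. Only the residue of the index modulo `m` matters, so
-- reducing `n * e` keeps it among the first `m` terms.
multiple-of-gcd-mod : ∀ d m .{{_ : NonZero m}} n →
                      ∃[ i ] i < m × (∀ t → (t + i * d) % m ≡ (t + n * gcd d m) % m)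
multiple-of-gcd-mod d m n with bézout-mod d m
... | e , a , b , eq = n * e % m , m%n<n (n * e) m , λ t → begin
  (t + i * d) % m                     ≡⟨ [m+kn]%n≡m%n (t + i * d) (q * d) m ⟨
  (t + i * d + q * d * m) % m         ≡⟨ cong (_% m) (collect t i q d m) ⟩
  (t + (i + q * m) * d) % m           ≡⟨ cong (λ z → (t + z * d) % m) (m≡m%n+[m/n]*n (n * e) m) ⟨
  (t + n * e * d) % m                 ≡⟨ [m+kn]%n≡m%n (t + n * e * d) (n * a) m ⟨
  (t + n * e * d + n * a * m) % m     ≡⟨ cong (_% m) (factor t n e d a m) ⟩
  (t + n * (e * d + a * m)) % m       ≡⟨ cong (λ z → (t + n * z) % m) eq ⟩
  (t + n * (gcd d m + b * m)) % m     ≡⟨ cong (_% m) (expand t n (gcd d m) b m) ⟩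
  (t + n * gcd d m + n * b * m) % m   ≡⟨ [m+kn]%n≡m%n (t + n * gcd d m) (n * b) m ⟩
  (t + n * gcd d m) % m               ∎
  where
  open ≡-Reasoning
  i = n * e % m
  q = n * e / m
  collect : ∀ t i q d m → t + i * d + q * d * m ≡ t + (i + q * m) * d
  collect = solve-∀
  factor : ∀ t n e d a m → t + n * e * d + n * a * m ≡ t + n * (e * d + a * m)
  factor = solve-∀
  expand : ∀ t n g b m → t + n * (g + b * m) ≡ t + n * g + n * b * m
  expand = solve-∀

-- Steps of length `g` starting at or below `B` cannot jump over the `g` numbers from `B` on.
next-step-beyond : ∀ g .{{_ : NonZero g}} t {B} → t ≤ B →
                   ∃[ n ] ∃[ s ] s < g × t + n * g ≡ B + s
next-step-beyond g@(suc g-1) t {B} t≤B =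
  -- `u / g` is `(B ∸ t) / g` rounded up. Adding `u % g` to both sides removes the truncated
  -- subtraction from the overshoot.
  u / g , g-1 ∸ u % g , s≤s (m∸n≤m g-1 (u % g)) , +-cancelʳ-≡ (u % g) _ _ (begin
    t + u / g * g + u % g         ≡⟨ +-assoc t _ _ ⟩
    t + (u / g * g + u % g)       ≡⟨ cong (t +_) (+-comm (u / g * g) _) ⟩
    t + (u % g + u / g * g)       ≡⟨ cong (t +_) (m≡m%n+[m/n]*n u g) ⟨
    t + (B ∸ t + g-1)             ≡⟨ +-assoc t _ _ ⟨
    t + (B ∸ t) + g-1             ≡⟨ cong (_+ g-1) (m+[n∸m]≡n t≤B) ⟩
    B + g-1                       ≡⟨ cong (B +_) (m∸n+n≡m (≤-pred (m%n<n u g))) ⟨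
    B + (g-1 ∸ u % g + u % g)     ≡⟨ +-assoc B _ _ ⟨
    B + (g-1 ∸ u % g) + u % g     ∎)
  where
  open ≡-Reasoning
  u = B ∸ t + g-1

gcd-nonZeroʳ : ∀ d m .{{_ : NonZero m}} → NonZero (gcd d m)
gcd-nonZeroʳ d m = ≢-nonZero (gcd[m,n]≢0 d m (inj₂ (m<n⇒n≢0 (m%n<n 0 m))))

-- Modulo `m` the progression reaches every `t + n * gcd d m`, and these are spaced too closely to
-- miss an interval of length `h`.
progression-meets-interval :
  ∀ d m .{{_ : NonZero m}} {h} → gcd d m ≤ h → ∀ {L} → L + h ≤ m → ∀ t →
  ∃[ i ] ∃[ s ] i < m × s < h × (t + i * d) % m ≡ L + s
progression-meets-interval d m g≤h {L} L+h≤m t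
  -- Shifting the interval by `t * m` keeps its residues and puts its left end at or beyond `t`.
  with n , s , s<g , eq ← next-step-beyond (gcd d m) {{gcd-nonZeroʳ d m}} t {L + t * m} (≤-trans (m≤m*n t m) (m≤n+m (t * m) L))
  with i , i<m , eq′ ← multiple-of-gcd-mod d m n
  = i , s , i<m , s<h , (begin
    (t + i * d) % m           ≡⟨ eq′ t ⟩
    (t + n * gcd d m) % m     ≡⟨ cong (_% m) eq ⟩
    (L + t * m + s) % m       ≡⟨ cong (_% m) (swap L (t * m) s) ⟩
    (L + s + t * m) % m       ≡⟨ [m+kn]%n≡m%n (L + s) t m ⟩
    (L + s) % m               ≡⟨ m<n⇒m%n≡m (<-≤-trans (+-monoʳ-< L s<h) L+h≤m) ⟩
    L + s                     ∎)
  where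
  open ≡-Reasoning
  s<h = <-≤-trans s<g g≤h
  swap : ∀ a b c → a + b + c ≡ a + c + b
  swap = solve-∀

-- The cofactor is at least 3: cofactors 0 and 2 make `m` even, and 1 makes `g` equal to `m`.
odd-proper-divisor : ∀ {g m} → ¬ 2 ∣ m → g ∣ m → g ≢ m → g * 3 ≤ m
odd-proper-divisor {g}     2∤m (divides 0 eq) _   = contradiction (divides 0 eq) 2∤m
odd-proper-divisor {g}     2∤m (divides 1 eq) g≢m = contradiction (trans (sym (*-identityˡ g)) (sym eq)) g≢m
odd-proper-divisor {g}     2∤m (divides 2 eq) _   = contradiction (divides g (trans eq (*-comm 2 g))) 2∤m
odd-proper-divisor {g} {m} 2∤m (divides (suc (suc (suc q))) eq) _ = begin
  g * 3                   ≤⟨ *-monoʳ-≤ g (m≤m+n 3 q) ⟩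
  g * suc (suc (suc q))   ≡⟨ *-comm g _ ⟩
  suc (suc (suc q)) * g   ≡⟨ eq ⟨
  m                       ∎
  where open ≤-Reasoning

mod-cong⁻¹ : ∀ x y n .{{_ : NonZero n}} → x mod n ≡ y mod n → x % n ≡ y % n
mod-cong⁻¹ x y n = fromℕ<-injective (x % n) (y % n) (m%n<n x n) (m%n<n y n)

/%-injective : ∀ x y n .{{_ : NonZero n}} → x % n ≡ y % n → x / n ≡ y / n → x ≡ y
/%-injective x y n r q = begin
  x                     ≡⟨ m≡m%n+[m/n]*n x n ⟩
  x % n + x / n * n     ≡⟨ cong₂ (λ a b → a + b * n) r q ⟩
  y % n + y / n * n     ≡⟨ m≡m%n+[m/n]*n y n ⟨
  y                     ∎
  where open ≡-Reasoning

term-% : ∀ q m .{{_ : NonZero m}} .{{_ : NonZero (q * m)}} t d i →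
         toℕ (term (q * m) t d i) % m ≡ (toℕ t + i * d) % m
term-% q m t d i = trans
  (cong (_% m) (toℕ-fromℕ< (m%n<n (toℕ t + i * d) (q * m))))
  (m∣n⇒o%n%m≡o%m m (q * m) (toℕ t + i * d) (n∣m*n q))

-- The colouring and its progressions.

module Construction (m : ℕ) .{{_ : NonZero m}} .{{_ : NonZero (m / 3)}} where

  -- The thirds have length `m / 3` rounded down; the at most two residues left over at the top have
  -- quotient 3 or more and are wrapped round by `mod 3`.
  forbidden : ℕ → Fin 3
  forbidden r = (r / (m / 3)) mod 3

  -- The parity of the quotient by `m` halves each class, and `punchIn` maps it into the two colours
  -- that the class may use.
  colour : ∀ {M} → Coloring 3 M
  colour x = punchIn (forbidden (toℕ x % m)) ((toℕ x / m) mod 2)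

  forbidden-interval : ∀ j {s} → s < m / 3 → forbidden (toℕ j * (m / 3) + s) ≡ j
  forbidden-interval j {s} s<h = toℕ-injective (begin
    toℕ (forbidden (toℕ j * h + s))   ≡⟨ toℕ-fromℕ< (m%n<n ((toℕ j * h + s) / h) 3) ⟩
    (toℕ j * h + s) / h % 3           ≡⟨ cong (_% 3) (+-distrib-/-∣ˡ s (n∣m*n (toℕ j))) ⟩
    (toℕ j * h / h + s / h) % 3       ≡⟨ cong₂ (λ a b → (a + b) % 3) (m*n/n≡m (toℕ j) h) (m<n⇒m/n≡0 s<h) ⟩
    (toℕ j + 0) % 3                   ≡⟨ cong (_% 3) (+-identityʳ (toℕ j)) ⟩
    toℕ j % 3                         ≡⟨ m<n⇒m%n≡m (toℕ<n j) ⟩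
    toℕ j                             ∎)
    where
    open ≡-Reasoning
    h = m / 3

  -- Within one class the colour determines the parity of `toℕ x / m`, so `x` is recovered from
  -- `toℕ x / m / 2`, which takes only `K` values.
  monochromatic-class-≤ : ∀ {K} (A : Subset (K * 2 * m)) r →
                          (∀ x → x ∈ A → toℕ x % m ≡ r) → Monochromatic colour A → ∣ A ∣ ≤ K
  monochromatic-class-≤ {K} A r A≡r mono = ∣A∣≤-injectiveOn A (λ x → fromℕ< (half< x)) inj
    where
    half< : ∀ (x : Fin (K * 2 * m)) → toℕ x / m / 2 < K
    half< x = m<n*o⇒m/o<n (m<n*o⇒m/o<n (toℕ<n x))

    inj : ∀ x y → x ∈ A → y ∈ A → fromℕ< (half< x) ≡ fromℕ< (half< y) → x ≡ y
    inj x y x∈A y∈A eq = toℕ-injective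
      (/%-injective (toℕ x) (toℕ y) m same-class
        (/%-injective (toℕ x / m) (toℕ y / m) 2
          (mod-cong⁻¹ (toℕ x / m) (toℕ y / m) 2 same-parity)
          (fromℕ<-injective _ _ (half< x) (half< y) eq)))
      where
      same-class : toℕ x % m ≡ toℕ y % m
      same-class = trans (A≡r x x∈A) (sym (A≡r y y∈A))
      same-parity : (toℕ x / m) mod 2 ≡ (toℕ y / m) mod 2
      same-parity = punchIn-injective (forbidden (toℕ x % m)) _ _
        (trans (mono x y x∈A y∈A)
          (cong (λ z → punchIn (forbidden z) ((toℕ y / m) mod 2)) (sym same-class)))

  colour≢forbidden : ∀ {M} (x : Fin M) → colour x ≢ forbidden (toℕ x % m)
  colour≢forbidden x = punchInᵢ≢i (forbidden (toℕ x % m)) ((toℕ x / m) mod 2)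

  AP-meets-every-forbidden : ∀ d → ¬ m ∣ d → ¬ 2 ∣ m → ∀ t j →
                             ∃[ i ] i < m × forbidden ((t + i * d) % m) ≡ j
  AP-meets-every-forbidden d m∤d 2∤m t j =
    let i , s , i<m , s<h , eq = progression-meets-interval d m g≤h {toℕ j * h} interval≤m t
    in i , i<m , trans (cong forbidden eq) (forbidden-interval j s<h)
    where
    open ≤-Reasoning
    h = m / 3
    g≤h : gcd d m ≤ h
    -- Since `m` does not divide `d`, the gcd is a proper divisor of the odd `m`.
    g≤h = subst (_≤ h) (m*n/n≡m (gcd d m) 3)
      (/-monoˡ-≤ 3 (odd-proper-divisor 2∤m (gcd[m,n]∣n d m) λ g≡m → m∤d (subst (_∣ d) g≡m (gcd[m,n]∣m d m))))
    interval≤m : toℕ j * h + h ≤ m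
    interval≤m = begin
      toℕ j * h + h     ≡⟨ +-comm (toℕ j * h) h ⟩
      suc (toℕ j) * h   ≤⟨ *-monoˡ-≤ h (toℕ<n j) ⟩
      3 * h             ≡⟨ *-comm 3 h ⟩
      h * 3             ≤⟨ m/n*n≤m m 3 ⟩
      m                 ∎

  no-monochromatic-AP : ∀ K .{{_ : NonZero (K * 2 * m)}} → m ≤ suc K → ¬ 2 ∣ m →
                        ¬ HasMonochromaticAP (suc K) 3 (K * 2 * m) colour
  no-monochromatic-AP K m≤k 2∤m (d , _ , A , (∣A∣≡k , t , A-AP) , mono) with m ∣? d
  ... | yes (divides q d≡qm) =
    1+n≰n (subst (_≤ K) ∣A∣≡k (monochromatic-class-≤ A (toℕ t % m) in-class mono))
    where
    in-class : ∀ x → x ∈ A → toℕ x % m ≡ toℕ t % m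
    in-class x x∈A with i , refl ← Equivalence.to (A-AP x) x∈A = begin
      toℕ (term (K * 2 * m) t d (toℕ i)) % m   ≡⟨ term-% (K * 2) m t d (toℕ i) ⟩
      (toℕ t + toℕ i * d) % m                  ≡⟨ cong (λ z → (toℕ t + toℕ i * z) % m) d≡qm ⟩
      (toℕ t + toℕ i * (q * m)) % m            ≡⟨ cong (λ z → (toℕ t + z) % m) (*-assoc (toℕ i) q m) ⟨
      (toℕ t + toℕ i * q * m) % m              ≡⟨ [m+kn]%n≡m%n (toℕ t) (toℕ i * q) m ⟩
      toℕ t % m                                ∎
      where open ≡-Reasoning
  ... | no m∤d =
    -- Take the common colour of the progression, read off at its first term: a term in a class that
    -- forbids this colour cannot have it.
    let i , i<m , forbids-j = AP-meets-every-forbidden d m∤d 2∤m (toℕ t) (colour (x 0))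
    in colour≢forbidden (x i) (begin
      colour (x i)                            ≡⟨ mono (x i) (x 0) (x-∈ i (<-≤-trans i<m m≤k)) (x-∈ 0 (s≤s z≤n)) ⟩
      colour (x 0)                            ≡⟨ forbids-j ⟨
      forbidden ((toℕ t + i * d) % m)         ≡⟨ cong forbidden (term-% (K * 2) m t d i) ⟨
      forbidden (toℕ (x i) % m)               ∎)
    where
    open ≡-Reasoning
    x : ℕ → Fin (K * 2 * m)
    x = term (K * 2 * m) t d
    x-∈ : ∀ i → i < suc K → x i ∈ A
    x-∈ i i<k = Equivalence.from (A-AP (x i)) (fromℕ< i<k , cong x (sym (toℕ-fromℕ< i<k)))

-- Choice of the modulus.

2∤1+2n : ∀ n → ¬ 2 ∣ 1 + n * 2
2∤1+2n n 2∣ = contradiction (∣1⇒≡1 (∣m+n∣m⇒∣n (subst (2 ∣_) (+-comm 1 (n * 2)) 2∣) (n∣m*n n))) λ ()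

-- The odd one of `K` and `suc K`, where `K` stands for `k - 1`.
oddModulus : ℕ → ℕ
oddModulus K = 1 + K / 2 * 2

oddModulus≤1+K : ∀ K → oddModulus K ≤ suc K
oddModulus≤1+K K = s≤s (m/n*n≤m K 2)

K≤oddModulus : ∀ K → K ≤ oddModulus K
K≤oddModulus K = begin
  K                   ≡⟨ m≡m%n+[m/n]*n K 2 ⟩
  K % 2 + K / 2 * 2   ≤⟨ +-monoˡ-≤ (K / 2 * 2) (≤-pred (m%n<n K 2)) ⟩
  1 + K / 2 * 2       ∎
  where open ≤-Reasoning

-- Ensures that the thirds have positive length.
3≤oddModulus : ∀ K → 2 ≤ K → 3 ≤ oddModulus K
3≤oddModulus K 2≤K = s≤s (*-monoˡ-≤ 2 (m≥n⇒m/n>0 {K} {2} 2≤K))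

[1+K]²≤2K*oddModulus : ∀ K → 2 ≤ K → suc K ^ 2 ≤ K * 2 * oddModulus K
[1+K]²≤2K*oddModulus 1 (s≤s ())
-- The modulus is 3, giving 9 ≤ 12; bounding it below by `K` would give only 8.
[1+K]²≤2K*oddModulus 2 _ = m≤m+n 9 3
[1+K]²≤2K*oddModulus K@(suc (suc (suc n))) _ = begin
  -- The added term is the difference `2 * K ^ 2 - suc K ^ 2` at `K = 3 + n`.
  suc K ^ 2                             ≤⟨ m≤m+n (suc K ^ 2) (n * n + 4 * n + 2) ⟩
  suc K ^ 2 + (n * n + 4 * n + 2)       ≡⟨ expand n ⟩
  K * 2 * K                             ≤⟨ *-monoʳ-≤ (K * 2) (K≤oddModulus K) ⟩
  K * 2 * oddModulus K                  ∎
  where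
  open ≤-Reasoning
  expand : ∀ n → (4 + n) * ((4 + n) * 1) + (n * n + 4 * n + 2) ≡ (3 + n) * 2 * (3 + n)
  expand = solve-∀

proposition4p7 : (k : ℕ) → 3 ≤ k → (W : ℕ) → IsCyclicVanDerWaerdenNumber k 3 W → W > k ^ 2
proposition4p7 (suc K) (s≤s 2≤K) W isW = ≰⇒> λ W≤k² →
  no-monochromatic-AP K (oddModulus≤1+K K) (2∤1+2n (K / 2))
    -- If `W` were at most `k ^ 2`, it would be at most `K * 2 * oddModulus K`, so a monochromatic
    -- progression would be forced there.
    (IsCyclicVanDerWaerdenNumber.forced isW (K * 2 * oddModulus K) (≤-trans W≤k² k²≤M) colour)
  where
  k²≤M = [1+K]²≤2K*oddModulus K 2≤K
  instance
    m/3≢0 : NonZero (oddModulus K / 3)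
    m/3≢0 = >-nonZero (m≥n⇒m/n>0 (3≤oddModulus K 2≤K))
    M≢0 : NonZero (K * 2 * oddModulus K)
    M≢0 = >-nonZero (≤-trans (s≤s z≤n) k²≤M)
  open Construction (oddModulus K)
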